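{- For every even positive integer $a$, there exists a structured $(a,1)$ knight's tour in $[6a+2]^2$.
   Context: $[N]=\{0,\dots,N-1\}$. The $(a,1)$ knight's graph on $[N]^2$ has vertex set $[N]^2$, with $(x,y)\sim(x',y')$ iff $\{|x-x'|,|y-y'|\}=\{a,1\}$; an $(a,1)$ knight's tour is a Hamiltonian cycle of this graph. It is structured if it contains every edge $\{(i,j),(i+a,\,j+(-1)^j)\}$ with $i,j\in\{0,\dots,a-1\}$. -}

module Defs where

open import Data.Nat using (ℕ; zero; suc; _+_; _*_; _<_; _≤_; ∣_-_∣)
open import Data.Nat.Divisibility using (_∣_)
open import Data.Product using (_×_; _,_; Σ)
open import Data.Sum using (_⊎_)
open import Data.List using (List; length; zip; drop; take; _++_)
open import Data.List.Relation.Unary.All using (All)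
open import Data.List.Relation.Unary.Unique.Propositional using (Unique)
open import Data.List.Membership.Propositional using (_∈_)
open import Relation.Binary.PropositionalEquality using (_≡_)

Cell : Set
Cell = ℕ × ℕ

OnBoard : ℕ → Cell → Set
OnBoard N (x , y) = x < N × y < N

KnightAdj : ℕ → Cell → Cell → Set
KnightAdj a (x , y) (x' , y') =
  (∣ x - x' ∣ ≡ a × ∣ y - y' ∣ ≡ 1) ⊎ (∣ x - x' ∣ ≡ 1 × ∣ y - y' ∣ ≡ a)

cyclicPairs : List Cell → List (Cell × Cell)
cyclicPairs vs = zip vs (drop 1 vs ++ take 1 vs)

-- A Hamiltonian cycle of the (a,1) knight's graph on [N]^2, given as the cyclic
-- list of its vertices: at least 3 vertices, all on the board, pairwise distinct,
-- exactly N*N of them (hence every vertex occurs), and cyclically consecutive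
-- vertices are adjacent.
IsKnightTour : ℕ → ℕ → List Cell → Set
IsKnightTour a N vs =
  3 ≤ length vs
  × All (OnBoard N) vs
  × Unique vs
  × length vs ≡ N * N
  × All (λ p → KnightAdj a (Data.Product.proj₁ p) (Data.Product.proj₂ p)) (cyclicPairs vs)

EdgeOf : Cell → Cell → List Cell → Set
EdgeOf u v vs = ((u , v) ∈ cyclicPairs vs) ⊎ ((v , u) ∈ cyclicPairs vs)

-- alt j = j + (-1)^j
alt : ℕ → ℕ
alt zero = 1
alt (suc zero) = 0
alt (suc (suc j)) = suc (suc (alt j))

Structured : ℕ → List Cell → Set
Structured a vs = ∀ i j → i < a → j < a → EdgeOf (i , j) (i + a , alt j) vs

StructuredKnightTour : ℕ → ℕ → List Cell → Set
StructuredKnightTour a N vs = IsKnightTour a N vs × Structured a vs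

{-# OPTIONS --safe #-}

-- For fixed i, j < a, a grid square (α , β) is placed at (α a + i , β a + j), with i replaced
-- by alt i when β is odd and j by alt j when α is odd.  A unit step on the grid then becomes
-- a knight move, so the board splits into a² grids (i , j) of width 6 (7 if i < 2) and height
-- 6 (7 if j < 2), and the required edges are the edges (0 , 0)–(1 , 0) of these grids.
--
-- Each grid is swept by one or two explicit routes, with a gap at one vertical edge.  A further
-- knight move leads from the grid (i , j) to (i , j + 2), so the sweep of (i , j + 2) is inserted
-- in the gap of (i , j); this gives towers standing on the grids (i , 0) and (i , 1).  Towers of
-- neighbouring i of the same parity are concatenated; moves that carry from one block of a
-- columns to the next lead from the grids j = 0 to the grids j = 1 and back.  This yields one
-- closed walk for even i and one for odd i.  The four 7 × 7 grids have an odd number of squares,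
-- so they cannot be closed up separately; here their routes start and end on the same colour.
-- A move carrying from one block of a rows to the next lets the odd walk be inserted in the
-- topmost gap over the grid (0 , 0).
--
-- The walk meets every cell and has as many entries as the board has cells, hence no repetition.
module Submission where

open import Defs
open import Data.List using (List; []; _∷_; [_]; _++_; map; zip; length; cartesianProduct; upTo)
open import Data.List.Membership.Propositional using (_∈_)
open import Data.List.Membership.Propositional.Properties
  using (∈-++⁺ˡ; ∈-++⁺ʳ; ∈-++⁻; ∈-∃++; ∈-map⁺; ∈-upTo⁺; ∈-upTo⁻; ∈-cartesianProduct⁺; ∈-cartesianProduct⁻)
open import Data.List.Properties using (++-assoc; ++-identityʳ; length-++; length-map; length-upTo)
open import Data.List.Relation.Binary.Permutation.Propositional
  using (_↭_; ↭-refl; ↭-sym; ↭-trans; ↭-prep; ↭⇒↭ₛ)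
open import Data.List.Relation.Binary.Permutation.Propositional.Properties using (shift; ↭-length; All-resp-↭)
open import Data.List.Relation.Unary.All as All using (All; []; _∷_; all?; lookup; tabulate)
open import Data.List.Relation.Unary.AllPairs using (_∷_)
open import Data.List.Relation.Unary.Any using (Any; here; there; any?)
open import Data.List.Relation.Unary.Unique.Propositional using (Unique)
open import Data.List.Relation.Unary.Unique.Propositional.Properties using (cartesianProduct⁺; upTo⁺)
open import Data.Nat using (ℕ; zero; suc; _+_; _*_; _<_; _≤_; ∣_-_∣; z≤n; s≤s)
open import Data.Nat.Divisibility using (_∣_; divides)
open import Data.Nat.DivMod using (_/_; _%_; m≡m%n+[m/n]*n; m%n<n; m<n*o⇒m/o<n)
open import Data.Nat.Properties hiding (_≟_)
open import Data.Nat.Tactic.RingSolver using (solve-∀)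
open import Data.Parity.Base using (Parity; 0ℙ; 1ℙ)
open import Data.Product using (∃; ∃₂; _×_; _,_; proj₁; proj₂)
open import Data.Product.Properties using (≡-dec)
open import Data.Sum using (_⊎_; inj₁; inj₂)
open import Relation.Binary.PropositionalEquality
  using (_≡_; refl; sym; trans; cong; cong₂; subst; setoid; module ≡-Reasoning)
open import Relation.Nullary using (Dec; yes; no; contradiction)
open import Relation.Nullary.Decidable using (from-yes; _×-dec_; _⊎-dec_)
import Data.List.Relation.Binary.Permutation.Setoid.Properties as SetoidPermutation

open SetoidPermutation (setoid Cell) using (Unique-resp-↭)

-- Routes on the small grids.

Square : Set
Square = ℕ × ℕ

infixr 5 ⇒_ ⇐_ ⇑_ ⇓_

-- With both ends as indices, type checking verifies where a route starts and stops; the `suc` in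
-- `⇐_` and `⇓_` keeps coordinates from going below 0.
data Route : Square → Square → Set where
  end : ∀ {g} → Route g g
  ⇒_  : ∀ {α β g} → Route (suc α , β) g → Route (α , β) g
  ⇐_  : ∀ {α β g} → Route (α , β) g → Route (suc α , β) g
  ⇑_  : ∀ {α β g} → Route (α , suc β) g → Route (α , β) g
  ⇓_  : ∀ {α β g} → Route (α , β) g → Route (α , suc β) g

squares : ∀ {g h} → Route g h → List Square
squares {g} end   = [ g ]
squares {g} (⇒ r) = g ∷ squares r
squares {g} (⇐ r) = g ∷ squares r
squares {g} (⇑ r) = g ∷ squares r
squares {g} (⇓ r) = g ∷ squares r

-- The parity argument is that of j: grids with j even and with j odd are nested at different
-- columns, because the row j + 1 next to j + 2 is occupied at odd α if j is even.
gap gap′ entry exit oddEnd : Parity → Square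
gap 0ℙ = 3 , 1
gap 1ℙ = 2 , 2
gap′ 0ℙ = 3 , 2
gap′ 1ℙ = 2 , 1
entry 0ℙ = 2 , 1
entry 1ℙ = 3 , 2
exit 0ℙ = 2 , 2
exit 1ℙ = 3 , 1
oddEnd 0ℙ = 2 , 3
oddEnd 1ℙ = 5 , 5

record Split (g h : Square) (t : Parity) : Set where
  field
    before : Route g (gap t)
    after  : Route (gap′ t) h

open Split

-- Each even grid is left at (5 , 5): for (5 , 4) of the next grid by `even-even`, or for (6 , 6) of
-- the first grid by `even-wrap`.
evenFirst : ∀ t → Split (6 , 6) (5 , 5) t
evenFirst 0ℙ = record
  { before = ⇐ ⇐ ⇐ ⇐ ⇐ ⇐ ⇓ ⇓ ⇓ ⇓ ⇓ ⇓ ⇒ ⇒ ⇒ ⇒ ⇒ ⇒ ⇑ ⇑ ⇑ ⇐ ⇐ ⇓ ⇒ ⇓ ⇐ ⇐ end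
  ; after  = ⇑ ⇑ ⇐ ⇓ ⇓ ⇓ ⇐ ⇑ ⇑ ⇑ ⇑ ⇒ ⇒ ⇒ ⇓ ⇒ ⇒ ⇑ ⇐ end
  }
evenFirst 1ℙ = record
  { before = ⇐ ⇐ ⇐ ⇐ ⇐ ⇐ ⇓ ⇓ ⇓ ⇓ ⇓ ⇓ ⇒ ⇒ ⇒ ⇒ ⇒ ⇒ ⇑ ⇑ ⇑ ⇐ ⇐ ⇓ ⇒ ⇓ ⇐ ⇐ ⇑ ⇑ ⇑ ⇐ ⇓ ⇓ end
  ; after  = ⇐ ⇑ ⇑ ⇑ ⇑ ⇒ ⇒ ⇒ ⇓ ⇒ ⇒ ⇑ ⇐ end
  }

evenNext : ∀ t → Split (5 , 4) (5 , 5) t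
evenNext 0ℙ = record
  { before = ⇐ ⇐ ⇐ ⇐ ⇓ ⇓ ⇓ ⇒ ⇒ end
  ; after  = ⇐ ⇑ ⇒ ⇒ ⇒ ⇓ ⇐ ⇓ ⇒ ⇓ ⇐ ⇐ ⇐ ⇐ ⇐ ⇑ ⇑ ⇑ ⇑ ⇑ ⇑ ⇒ ⇓ ⇒ ⇑ ⇒ ⇓ ⇒ ⇑ ⇒ ⇓ end
  }
evenNext 1ℙ = record
  { before = ⇐ ⇐ ⇐ ⇐ ⇓ ⇒ ⇒ ⇒ ⇒ ⇓ ⇓ ⇓ ⇐ ⇐ ⇑ ⇒ ⇑ ⇐ ⇐ end
  ; after  = ⇓ ⇐ ⇐ ⇑ ⇒ ⇑ ⇐ ⇑ ⇑ ⇑ ⇑ ⇒ ⇓ ⇒ ⇑ ⇒ ⇓ ⇒ ⇑ ⇒ ⇓ end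
  }

-- Odd grids are met in decreasing order of i: `alt` lowers an odd index, so the move from (4 , 5)
-- to (4 , 4) leads from i + 2 to i.
oddNext : ∀ t → Split (4 , 4) (4 , 5) t
oddNext 0ℙ = record
  { before = ⇒ ⇑ ⇑ ⇐ ⇐ ⇐ ⇐ ⇐ ⇓ ⇓ ⇓ ⇓ ⇓ ⇓ ⇒ ⇒ ⇒ ⇒ ⇒ ⇑ ⇑ ⇑ ⇐ ⇓ ⇓ ⇐ end
  ; after  = ⇑ ⇑ ⇐ ⇓ ⇓ ⇓ ⇐ ⇑ ⇑ ⇑ ⇑ ⇒ ⇒ ⇒ end
  }
oddNext 1ℙ = record
  { before = ⇒ ⇑ ⇑ ⇐ ⇐ ⇐ ⇐ ⇐ ⇓ ⇓ ⇓ ⇓ ⇓ ⇓ ⇒ ⇒ ⇒ ⇒ ⇒ ⇑ ⇑ ⇑ ⇐ ⇓ ⇓ ⇐ ⇑ ⇑ ⇑ ⇐ ⇓ ⇓ end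
  ; after  = ⇐ ⇑ ⇑ ⇑ ⇑ ⇒ ⇒ ⇒ end
  }

-- The walk through the odd grids is cut open inside the grid (1 , 0), between (2 , 3) and (2 , 2):
-- it begins with oddHead and ends with oddLast 0ℙ.
oddLast : ∀ t → Split (4 , 4) (oddEnd t) t
oddLast 0ℙ = record
  { before = ⇒ ⇒ ⇑ ⇑ ⇐ ⇐ ⇐ ⇐ ⇐ ⇐ ⇓ ⇓ ⇓ ⇓ ⇓ ⇓ ⇒ ⇒ ⇒ ⇒ ⇒ ⇒ ⇑ ⇑ ⇑ ⇐ ⇐ ⇓ ⇒ ⇓ ⇐ ⇐ end
  ; after  = ⇑ ⇑ ⇐ ⇓ end
  }
oddLast 1ℙ = record
  { before = ⇒ ⇒ ⇑ ⇑ ⇐ ⇐ ⇐ ⇐ ⇐ ⇐ ⇓ ⇓ ⇓ ⇓ ⇓ ⇓ ⇒ ⇒ ⇒ ⇒ ⇒ ⇒ ⇑ ⇑ ⇑ ⇐ ⇐ ⇓ ⇒ ⇓ ⇐ ⇐ ⇑ ⇑ ⇑ ⇐ ⇓ ⇓ end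
  ; after  = ⇐ ⇑ ⇑ ⇑ ⇑ ⇒ ⇒ ⇒ ⇒ end
  }

oddHead : Route (2 , 2) (5 , 5)
oddHead = ⇓ ⇐ ⇑ ⇑ ⇑ ⇑ ⇒ ⇒ ⇒ ⇒ end

wide : ∀ t → Split (entry t) (exit t) t
wide 0ℙ = record
  { before = ⇐ ⇐ ⇓ ⇒ ⇒ ⇒ ⇒ ⇒ ⇒ ⇑ ⇐ ⇐ ⇐ end
  ; after  = ⇒ ⇒ ⇒ ⇑ ⇐ ⇐ ⇐ ⇑ ⇒ ⇒ ⇒ ⇑ ⇐ ⇐ ⇐ ⇐ ⇐ ⇐ ⇓ ⇒ ⇒ ⇓ ⇐ ⇐ ⇓ ⇒ ⇒ end
  }
wide 1ℙ = record
  { before = ⇒ ⇒ ⇒ ⇑ ⇐ ⇐ ⇐ ⇑ ⇒ ⇒ ⇒ ⇑ ⇐ ⇐ ⇐ ⇐ ⇐ ⇐ ⇓ ⇒ ⇒ ⇓ ⇐ ⇐ ⇓ ⇒ ⇒ end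
  ; after  = ⇐ ⇐ ⇓ ⇒ ⇒ ⇒ ⇒ ⇒ ⇒ ⇑ ⇐ ⇐ ⇐ end
  }

narrow : ∀ t → Split (entry t) (exit t) t
narrow 0ℙ = record
  { before = ⇐ ⇐ ⇓ ⇒ ⇒ ⇒ ⇒ ⇒ ⇑ ⇐ ⇐ end
  ; after  = ⇒ ⇒ ⇑ ⇐ ⇐ ⇑ ⇒ ⇒ ⇑ ⇐ ⇐ ⇐ ⇐ ⇐ ⇓ ⇒ ⇒ ⇓ ⇐ ⇐ ⇓ ⇒ ⇒ end
  }
narrow 1ℙ = record
  { before = ⇒ ⇒ ⇑ ⇐ ⇐ ⇑ ⇒ ⇒ ⇑ ⇐ ⇐ ⇐ ⇐ ⇐ ⇓ ⇒ ⇒ ⇓ ⇐ ⇐ ⇓ ⇒ ⇒ end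
  ; after  = ⇐ ⇐ ⇓ ⇒ ⇒ ⇒ ⇒ ⇒ ⇑ ⇐ ⇐ end
  }

filler : ∀ (i : ℕ) t → Split (entry t) (exit t) t
filler 0             = wide
filler 1             = wide
filler (suc (suc _)) = narrow

-- Checking the routes by evaluation.

data Next {A : Set} (u v : A) : List A → Set where
  here  : ∀ {xs} → Next u v (u ∷ v ∷ xs)
  there : ∀ {x xs} → Next u v xs → Next u v (x ∷ xs)

_≟_ : (g h : Square) → Dec (g ≡ h)
_≟_ = ≡-dec Data.Nat._≟_ Data.Nat._≟_

next? : ∀ u v (xs : List Square) → Dec (Next u v xs)
next? u v []           = no λ ()
next? u v (x ∷ [])     = no λ { (there ()) }
next? u v (x ∷ y ∷ xs) with u ≟ x | v ≟ y | next? u v (y ∷ xs)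
... | yes refl | yes refl | _      = yes here
... | _        | _        | yes p  = yes (there p)
... | no u≢x   | _        | no ¬p  = no λ { here → u≢x refl ; (there p) → ¬p p }
... | yes _    | no v≢y   | no ¬p  = no λ { here → v≢y refl ; (there p) → ¬p p }

Joined : {A : Set} → A → A → List A → Set
Joined u v xs = Next u v xs ⊎ Next v u xs

-- Repeated squares are not excluded here; the total length of the tour excludes them later.
Complete : ℕ → ℕ → List (List Square) → Set
Complete w k ss =
  All (λ g → Any (g ∈_) ss) (cartesianProduct (upTo w) (upTo k))
  × Any (Joined (0 , 0) (1 , 0)) ss

complete? : ∀ w k ss → Dec (Complete w k ss)
complete? w k ss =
  all? (λ g → any? (λ s → any? (g ≟_) s) ss) (cartesianProduct (upTo w) (upTo k))
  ×-dec any? (λ s → next? (0 , 0) (1 , 0) s ⊎-dec next? (1 , 0) (0 , 0) s) ss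

parts : ∀ {g h t} → Split g h t → List (List Square)
parts s = squares (before s) ∷ squares (after s) ∷ []

size : ℕ → ℕ
size 0             = 7
size 1             = 7
size (suc (suc _)) = 6

evenFirst-complete : ∀ t → Complete 7 7 (parts (evenFirst t))
evenFirst-complete 0ℙ = from-yes (complete? 7 7 (parts (evenFirst 0ℙ)))
evenFirst-complete 1ℙ = from-yes (complete? 7 7 (parts (evenFirst 1ℙ)))

evenNext-complete : ∀ t → Complete 6 7 (parts (evenNext t))
evenNext-complete 0ℙ = from-yes (complete? 6 7 (parts (evenNext 0ℙ)))
evenNext-complete 1ℙ = from-yes (complete? 6 7 (parts (evenNext 1ℙ)))

oddNext-complete : ∀ t → Complete 6 7 (parts (oddNext t))
oddNext-complete 0ℙ = from-yes (complete? 6 7 (parts (oddNext 0ℙ)))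
oddNext-complete 1ℙ = from-yes (complete? 6 7 (parts (oddNext 1ℙ)))

oddLast₀-complete : Complete 7 7 (squares oddHead ∷ parts (oddLast 0ℙ))
oddLast₀-complete = from-yes (complete? 7 7 (squares oddHead ∷ parts (oddLast 0ℙ)))

oddLast₁-complete : Complete 7 7 (parts (oddLast 1ℙ))
oddLast₁-complete = from-yes (complete? 7 7 (parts (oddLast 1ℙ)))

filler-complete : ∀ i t → Complete (size i) 6 (parts (filler i t))
filler-complete 0             0ℙ = from-yes (complete? 7 6 (parts (wide 0ℙ)))
filler-complete 0             1ℙ = from-yes (complete? 7 6 (parts (wide 1ℙ)))
filler-complete 1             t  = filler-complete 0 t
filler-complete (suc (suc _)) 0ℙ = from-yes (complete? 6 6 (parts (narrow 0ℙ)))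
filler-complete (suc (suc _)) 1ℙ = from-yes (complete? 6 6 (parts (narrow 1ℙ)))

-- Arithmetic of `alt` and `twist`.

∣i-alt-i∣≡1 : ∀ i → ∣ i - alt i ∣ ≡ 1
∣i-alt-i∣≡1 0             = refl
∣i-alt-i∣≡1 1             = refl
∣i-alt-i∣≡1 (suc (suc i)) = ∣i-alt-i∣≡1 i

alt-involutive : ∀ i → alt (alt i) ≡ i
alt-involutive 0             = refl
alt-involutive 1             = refl
alt-involutive (suc (suc i)) = cong (2 +_) (alt-involutive i)

alt-even : ∀ n → alt (n * 2) ≡ suc (n * 2)
alt-even zero    = refl
alt-even (suc n) = cong (2 +_) (alt-even n)

alt-odd : ∀ n → alt (suc (n * 2)) ≡ n * 2
alt-odd zero    = refl
alt-odd (suc n) = cong (2 +_) (alt-odd n)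

alt-< : ∀ n {i} → i < n * 2 → alt i < n * 2
alt-< (suc n) {0}           _               = s≤s (s≤s z≤n)
alt-< (suc n) {1}           _               = s≤s z≤n
alt-< (suc n) {suc (suc i)} (s≤s (s≤s i<)) = s≤s (s≤s (alt-< n i<))

-- `alt` exchanges 0 and 1, the two indices of size 7.
size-alt : ∀ i → size (alt i) ≡ size i
size-alt 0             = refl
size-alt 1             = refl
size-alt (suc (suc i)) = refl

twist : ℕ → ℕ → ℕ
twist 0             i = i
twist 1             i = alt i
twist (suc (suc β)) i = twist β i

∣twist-twist∣≡1 : ∀ β i → ∣ twist β i - twist (suc β) i ∣ ≡ 1
∣twist-twist∣≡1 0             i = ∣i-alt-i∣≡1 i
∣twist-twist∣≡1 1             i = trans (∣-∣-comm (alt i) i) (∣i-alt-i∣≡1 i)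
∣twist-twist∣≡1 (suc (suc β)) i = ∣twist-twist∣≡1 β i

twist-involutive : ∀ β i → twist β (twist β i) ≡ i
twist-involutive 0             i = refl
twist-involutive 1             i = alt-involutive i
twist-involutive (suc (suc β)) i = twist-involutive β i

twist-< : ∀ β n {i} → i < n * 2 → twist β i < n * 2
twist-< 0             n i< = i<
twist-< 1             n i< = alt-< n i<
twist-< (suc (suc β)) n i< = twist-< β n i<

size-twist : ∀ β i → size (twist β i) ≡ size i
size-twist 0             i = refl
size-twist 1             i = size-alt i
size-twist (suc (suc β)) i = size-twist β i

-- Covering and counting.

-- The elements of `xs` are taken out of `ys` one by one; distinctness keeps the later ones in what
-- remains.
⊆⇒↭ : {A : Set} {xs ys : List A} → Unique xs → (∀ {x} → x ∈ xs → x ∈ ys) →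
  ∃ λ zs → ys ↭ xs ++ zs
⊆⇒↭ {xs = []}     {ys} _         _     = ys , ↭-refl
⊆⇒↭ {xs = x ∷ xs}      (x∉ ∷ uq) xs⊆ys with ∈-∃++ (xs⊆ys (here refl))
... | ps , qs , refl = let zs , perm = ⊆⇒↭ uq xs⊆ in zs , ↭-trans (shift x ps qs) (↭-prep x perm)
  where
  xs⊆ : ∀ {y} → y ∈ xs → y ∈ ps ++ qs
  xs⊆ y∈ with ∈-++⁻ ps (xs⊆ys (there y∈))
  ... | inj₁ y∈ps         = ∈-++⁺ˡ y∈ps
  ... | inj₂ (here refl)  = contradiction refl (lookup x∉ y∈)
  ... | inj₂ (there y∈qs) = ∈-++⁺ʳ ps y∈qs

⊆∧length⇒↭ : {A : Set} {xs ys : List A} → Unique xs → (∀ {x} → x ∈ xs → x ∈ ys) →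
  length ys ≡ length xs → ys ↭ xs
⊆∧length⇒↭ {xs = xs} {ys} uq xs⊆ys eq with ⊆⇒↭ uq xs⊆ys
... | []     , perm = subst (ys ↭_) (++-identityʳ xs) perm
... | z ∷ zs , perm = contradiction
  (trans (sym eq) (trans (↭-length perm) (trans (length-++ xs) (+-suc (length xs) (length zs)))))
  (m≢1+m+n (length xs))

board : ℕ → List Cell
board n = cartesianProduct (upTo n) (upTo n)

length-cartesianProduct : {A B : Set} (xs : List A) (ys : List B) →
  length (cartesianProduct xs ys) ≡ length xs * length ys
length-cartesianProduct []       ys = refl
length-cartesianProduct (x ∷ xs) ys = trans (length-++ (map (x ,_) ys))
  (cong₂ _+_ (length-map (x ,_) ys) (length-cartesianProduct xs ys))

length-board : ∀ n → length (board n) ≡ n * n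
length-board n = trans (length-cartesianProduct (upTo n) (upTo n)) (cong₂ _*_ (length-upTo n) (length-upTo n))

board-OnBoard : ∀ n → All (OnBoard n) (board n)
board-OnBoard n = tabulate λ c∈ →
  let x∈ , y∈ = ∈-cartesianProduct⁻ (upTo n) (upTo n) c∈ in ∈-upTo⁻ x∈ , ∈-upTo⁻ y∈

board-∈ : ∀ {n c} → c ∈ board n → OnBoard n c
board-∈ {n} = lookup (board-OnBoard n)

board-Unique : ∀ n → Unique (board n)
board-Unique n = cartesianProduct⁺ (upTo⁺ n) (upTo⁺ n)

-- Knight moves, walks and bridges.

-- A record, unlike KnightAdj, lets Agda infer the two cells.
record Move (a : ℕ) (u v : Cell) : Set where
  constructor move
  field
    adjacent : KnightAdj a u v

open Move

Move-sym : ∀ {a u v} → Move a u v → Move a v u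
Move-sym {u = x , y} {x′ , y′} (move (inj₁ (p , q))) =
  move (inj₁ (trans (∣-∣-comm x′ x) p , trans (∣-∣-comm y′ y) q))
Move-sym {u = x , y} {x′ , y′} (move (inj₂ (p , q))) =
  move (inj₂ (trans (∣-∣-comm x′ x) p , trans (∣-∣-comm y′ y) q))

data Walk (a : ℕ) : Cell → Cell → List Cell → Set where
  stay : ∀ {u} → Walk a u u [ u ]
  step : ∀ {u v w vs} → Move a u v → Walk a v w vs → Walk a u w (u ∷ vs)

-- A gap is closed by its own edge at the top of a tower, and by a detour elsewhere; both cases are
-- treated alike.
data Bridge (a : ℕ) (u v : Cell) : List Cell → Set where
  edge : Move a u v → Bridge a u v []
  span : ∀ {x y vs} → Move a u x → Walk a x y vs → Move a y v → Bridge a u v vs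

join : ∀ {a u v w z xs ys} → Walk a u v xs → Move a v w → Walk a w z ys → Walk a u z (xs ++ ys)
join stay       e q = step e q
join (step d p) e q = step d (join p e q)

join-bridge : ∀ {a t u v w xs ys zs} →
  Walk a t u xs → Bridge a u v ys → Walk a v w zs → Walk a t w (xs ++ ys ++ zs)
join-bridge p (edge e)     q = join p e q
join-bridge p (span d r e) q = join p d (join r e q)

closed-walk : ∀ {a u v vs} → Walk a u v vs → Move a v u →
  All (λ p → KnightAdj a (proj₁ p) (proj₂ p)) (cyclicPairs vs)
closed-walk stay e = adjacent e ∷ []
closed-walk {a} (step d p) e = go d p e
  where
  -- `z` stands for the first cell of the cycle, which `cyclicPairs` appends at the end and which
  -- stays fixed in the recursion.
  go : ∀ {u v w z vs} → Move a u v → Walk a v w vs → Move a w z →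
    All (λ p → KnightAdj a (proj₁ p) (proj₂ p)) (zip (u ∷ vs) (vs ++ [ z ]))
  go d stay       e = adjacent d ∷ adjacent e ∷ []
  go d (step c p) e = adjacent d ∷ go c p e

Next⇒cyclic : ∀ {u v vs} → Next u v vs → (u , v) ∈ cyclicPairs vs
Next⇒cyclic {u} {v} {x ∷ xs} = go x xs
  where
  go : ∀ y ys {zs} → Next u v (y ∷ ys) → (u , v) ∈ zip (y ∷ ys) (ys ++ zs)
  go _ (_ ∷ _)  here      = here refl
  go _ (y ∷ ys) (there p) = there (go y ys p)
  go _ []       (there ())

-- Contiguous sublists.

infix 4 _⊑_

_⊑_ : {A : Set} → List A → List A → Set
xs ⊑ vs = ∃₂ λ ps qs → vs ≡ ps ++ xs ++ qs

⊑-++ˡ : {A : Set} {xs vs : List A} (ys : List A) → xs ⊑ vs → xs ⊑ ys ++ vs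
⊑-++ˡ ys (ps , qs , refl) = ys ++ ps , qs , sym (++-assoc ys ps _)

⊑-++ʳ : {A : Set} {xs vs : List A} (ys : List A) → xs ⊑ vs → xs ⊑ vs ++ ys
⊑-++ʳ {xs = xs} ys (ps , qs , refl) = ps , qs ++ ys ,
  trans (++-assoc ps (xs ++ qs) ys) (cong (ps ++_) (++-assoc xs qs ys))

prefix : {A : Set} {xs : List A} (ys : List A) → xs ⊑ xs ++ ys
prefix ys = [] , ys , refl

suffix : {A : Set} (xs : List A) {ys : List A} → ys ⊑ xs ++ ys
suffix xs {ys} = xs , [] , cong (xs ++_) (sym (++-identityʳ ys))

⊑-trans : {A : Set} {xs ys zs : List A} → xs ⊑ ys → ys ⊑ zs → xs ⊑ zs
⊑-trans xs⊑ys (ps , qs , refl) = ⊑-++ˡ ps (⊑-++ʳ qs xs⊑ys)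

∈-⊑ : {A : Set} {x : A} {xs vs : List A} → xs ⊑ vs → x ∈ xs → x ∈ vs
∈-⊑ (ps , qs , refl) x∈ = ∈-++⁺ʳ ps (∈-++⁺ˡ x∈)

Next-⊑ : {A : Set} {u v : A} {xs vs : List A} → xs ⊑ vs → Next u v xs → Next u v vs
Next-⊑ {u = u} {v} ([] , qs , refl) p = go p
  where
  go : ∀ {xs} → Next u v xs → Next u v (xs ++ qs)
  go here      = here
  go (there p) = there (go p)
Next-⊑ (_ ∷ ps , qs , refl) p = there (Next-⊑ (ps , qs , refl) p)

Next-map : {A B : Set} (f : A → B) {u v : A} {xs : List A} → Next u v xs → Next (f u) (f v) (map f xs)
Next-map f here      = here
Next-map f (there p) = there (Next-map f p)

-- Parity and halving of indices.

-- The accumulating form matches the recursion of `nest`, so that the indices there agree by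
-- computation.
raise : ℕ → ℕ → ℕ
raise zero    j = j
raise (suc n) j = raise n (2 + j)

raise-+2 : ∀ n j → raise n (2 + j) ≡ 2 + raise n j
raise-+2 zero    j = refl
raise-+2 (suc n) j = raise-+2 n (2 + j)

raise-* : ∀ n j → raise n j ≡ n * 2 + j
raise-* zero    j = refl
raise-* (suc n) j = trans (raise-+2 n j) (cong (2 +_) (raise-* n j))

bit : Parity → ℕ
bit 0ℙ = 0
bit 1ℙ = 1

-- Parity is recorded as the equation that `climb₀` and `climb₁` consume.
HasParity : Parity → ℕ → Set
HasParity 0ℙ j = alt j ≡ suc j
HasParity 1ℙ j = j ≡ suc (alt j)

HasParity-+2 : ∀ t {j} → HasParity t j → HasParity t (2 + j)
HasParity-+2 0ℙ = cong (2 +_)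
HasParity-+2 1ℙ = cong (2 +_)

bit-parity : ∀ t → HasParity t (bit t)
bit-parity 0ℙ = refl
bit-parity 1ℙ = refl

halve : ∀ h {i} → i < h * 2 → ∃₂ λ I s → I < h × i ≡ bit s + I * 2
halve (suc h) {0}           _ = 0 , 0ℙ , s≤s z≤n , refl
halve (suc h) {1}           _ = 0 , 1ℙ , s≤s z≤n , refl
halve (suc h) {suc (suc i)} (s≤s (s≤s i<)) with halve h i<
... | I , 0ℙ , I<h , i≡ = suc I , 0ℙ , s≤s I<h , cong (2 +_) i≡
... | I , 1ℙ , I<h , i≡ = suc I , 1ℙ , s≤s I<h , cong (2 +_) i≡

∣n-1+n∣≡1 : ∀ n → ∣ n - suc n ∣ ≡ 1
∣n-1+n∣≡1 zero    = refl
∣n-1+n∣≡1 (suc n) = ∣n-1+n∣≡1 n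

-- Placing the grids, and knight moves within and between them.

module _ (m : ℕ) where

  a : ℕ
  a = suc m * 2

  place : ℕ → ℕ → Square → Cell
  place i j (α , β) = α * a + twist β i , β * a + twist α j

  far : ∀ k r → ∣ k * a + r - suc k * a + r ∣ ≡ a
  far k r = begin
    ∣ k * a + r - a + k * a + r ∣     ≡⟨ cong ∣ k * a + r -_∣ (+-assoc a (k * a) r) ⟩
    ∣ k * a + r - a + (k * a + r) ∣   ≡⟨ cong ∣ k * a + r -_∣ (+-comm a (k * a + r)) ⟩
    ∣ k * a + r - (k * a + r) + a ∣   ≡⟨ ∣m-m+n∣≡n (k * a + r) a ⟩
    a                                 ∎
    where open ≡-Reasoning

  far′ : ∀ k r → ∣ suc k * a + r - k * a + r ∣ ≡ a
  far′ k r = trans (∣-∣-comm (suc k * a + r) (k * a + r)) (far k r)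

  near : ∀ k {r s} → ∣ r - s ∣ ≡ 1 → ∣ k * a + r - k * a + s ∣ ≡ 1
  near k {r} {s} p = trans (∣m+n-m+o∣≡∣n-o∣ (k * a) r s) p

  -- `suc (m * 2)` is a - 1, the last offset in a block of length a.
  carry : ∀ k → ∣ k * a + suc (m * 2) - suc k * a + 0 ∣ ≡ 1
  carry k = trans (cong ∣ k * a + suc (m * 2) -_∣ eq) (∣n-1+n∣≡1 (k * a + suc (m * 2)))
    where
    eq : suc k * a + 0 ≡ suc (k * a + suc (m * 2))
    eq = begin
      a + k * a + 0               ≡⟨ +-identityʳ (a + k * a) ⟩
      a + k * a                   ≡⟨ +-comm a (k * a) ⟩
      k * a + suc (suc (m * 2))   ≡⟨ +-suc (k * a) (suc (m * 2)) ⟩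
      suc (k * a + suc (m * 2))   ∎
      where open ≡-Reasoning

  -- The x-offset depends on β and the y-offset on α: a step in α changes x by exactly a and flips
  -- only the y-offset.
  right : ∀ i j α β → Move a (place i j (α , β)) (place i j (suc α , β))
  right i j α β = move (inj₁ (far α (twist β i) , near β (∣twist-twist∣≡1 α j)))

  up : ∀ i j α β → Move a (place i j (α , β)) (place i j (α , suc β))
  up i j α β = move (inj₂ (near α (∣twist-twist∣≡1 β i) , far β (twist α j)))

  trace : ∀ {g h} → ℕ → ℕ → Route g h → List Cell
  trace i j r = map (place i j) (squares r)

  trace-walk : ∀ i j {g h} (r : Route g h) → Walk a (place i j g) (place i j h) (trace i j r)
  trace-walk i j end = stay
  trace-walk i j (⇒_ {α} {β} r) = step (right i j α β) (trace-walk i j r)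
  trace-walk i j (⇐_ {α} {β} r) = step (Move-sym (right i j α β)) (trace-walk i j r)
  trace-walk i j (⇑_ {α} {β} r) = step (up i j α β) (trace-walk i j r)
  trace-walk i j (⇓_ {α} {β} r) = step (Move-sym (up i j α β)) (trace-walk i j r)

  -- Column 3 is twisted and column 2 is not, so offset j + 1 lies next to offset j + 2.
  climb₀ : ∀ i j β → HasParity 0ℙ j → Move a (place i j (3 , β)) (place i (2 + j) (2 , β))
  climb₀ i j β p = move (inj₁ (far′ 2 (twist β i) , near β (trans (cong ∣_- 2 + j ∣ p) (∣n-1+n∣≡1 j))))

  climb₁ : ∀ i j β → HasParity 1ℙ j → Move a (place i j (2 , β)) (place i (2 + j) (3 , β))
  climb₁ i j β p = move (inj₁ (far 2 (twist β i) , near β (trans (cong ∣_- 2 + alt j ∣ p) (∣n-1+n∣≡1 (alt j)))))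

  gap-entry : ∀ t i {j} → HasParity t j → Move a (place i j (gap t)) (place i (2 + j) (entry t))
  gap-entry 0ℙ i {j} = climb₀ i j 1
  gap-entry 1ℙ i {j} = climb₁ i j 2

  exit-gap : ∀ t i {j} → HasParity t j → Move a (place i (2 + j) (exit t)) (place i j (gap′ t))
  exit-gap 0ℙ i {j} p = Move-sym (climb₀ i j 2 p)
  exit-gap 1ℙ i {j} p = Move-sym (climb₁ i j 1 p)

  gap-edge : ∀ t i j → Move a (place i j (gap t)) (place i j (gap′ t))
  gap-edge 0ℙ i j = up i j 3 1
  gap-edge 1ℙ i j = Move-sym (up i j 2 1)

  -- At β = 5 the index `n * 2` is twisted to its successor, one short of `suc n * 2`, which is
  -- untwisted at β = 4.
  even-even : ∀ n j → Move a (place (n * 2) j (5 , 5)) (place (suc n * 2) j (5 , 4))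
  even-even n j = move (inj₂
    (near 5 (trans (cong ∣_- suc n * 2 ∣ (alt-even n)) (∣n-1+n∣≡1 (n * 2))) , far′ 4 (twist 5 j)))

  odd-odd : ∀ n j → Move a (place (suc (suc n * 2)) j (4 , 5)) (place (suc (n * 2)) j (4 , 4))
  odd-odd n j = Move-sym (move (inj₂
    (near 4 (trans (cong ∣ suc (n * 2) -_∣ (alt-odd (suc n))) (∣n-1+n∣≡1 (n * 2))) , far 4 (twist 4 j))))

  -- The last even index is twisted to offset a - 1, and `carry` enters the next block. The y-offset
  -- `alt j` of column 5 is untwisted in column 6, which exchanges j = 0 and j = 1.
  even-wrap : ∀ j → Move a (place (m * 2) j (5 , 5)) (place 0 (alt j) (6 , 6))
  even-wrap j = move (inj₂ (trans (cong (λ r → ∣ 5 * a + r - 6 * a + 0 ∣) (alt-even m)) (carry 5) , far 5 (alt j)))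

  odd-wrap : ∀ j → Move a (place 1 j (5 , 5)) (place (suc (m * 2)) (alt j) (4 , 4))
  odd-wrap j = move (inj₂ (trans (∣-∣-comm (5 * a + 0) (4 * a + suc (m * 2))) (carry 4) , far′ 4 (alt j)))

  -- In column 3 the index `m * 2` is twisted to a - 1, so here and in `odd-even` the two cells of
  -- the gap lie in the last rows of blocks 1 and 2, next to the first rows of blocks 2 and 3.
  even-odd : Move a (place 0 (m * 2) (3 , 1)) (place 1 0 (2 , 2))
  even-odd = move (inj₁ (far′ 2 1 , trans (cong (λ r → ∣ 1 * a + r - 2 * a + 0 ∣) (alt-even m)) (carry 1)))

  odd-even : Move a (place 1 0 (2 , 3)) (place 0 (m * 2) (3 , 2))
  odd-even = Move-sym
    (move (inj₁ (far′ 2 0 , trans (cong (λ r → ∣ 2 * a + r - 3 * a + 0 ∣) (alt-even m)) (carry 2))))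

  -- Nesting sweeps into towers and joining towers into the tour.

  nest : ℕ → Parity → ℕ → ℕ → List Cell → List Cell
  nest i t zero    j vs = vs
  nest i t (suc n) j vs =
    trace i j (before (filler i t)) ++ nest i t n (2 + j) vs ++ trace i j (after (filler i t))

  -- The sweep of the next grid, with its own gap bridged by induction, is the detour for the gap
  -- below; the given bridge crosses the topmost gap.
  nest-bridge : ∀ i t n {j vs} → HasParity t j →
    Bridge a (place i (raise n j) (gap t)) (place i (raise n j) (gap′ t)) vs →
    Bridge a (place i j (gap t)) (place i j (gap′ t)) (nest i t n (2 + j) vs)
  nest-bridge i t zero    p b = b
  nest-bridge i t (suc n) {j} p b = span (gap-entry t i p)
    (join-bridge (trace-walk i (2 + j) (before (filler i t)))
                 (nest-bridge i t n (HasParity-+2 t p) b)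
                 (trace-walk i (2 + j) (after (filler i t))))
    (exit-gap t i p)

  tower : ∀ {g h} (i : ℕ) (t : Parity) → Split g h t → List Cell → List Cell
  tower i t s vs = trace i (bit t) (before s) ++ nest i t m (2 + bit t) vs ++ trace i (bit t) (after s)

  tower-bridge : ∀ {g h} i t (s : Split g h t) {vs} →
    Bridge a (place i (raise m (bit t)) (gap t)) (place i (raise m (bit t)) (gap′ t)) vs →
    Walk a (place i (bit t) g) (place i (bit t) h) (tower i t s vs)
  tower-bridge i t s b = join-bridge (trace-walk i (bit t) (before s))
    (nest-bridge i t m (bit-parity t) b) (trace-walk i (bit t) (after s))

  tower-walk : ∀ {g h} i t (s : Split g h t) →
    Walk a (place i (bit t) g) (place i (bit t) h) (tower i t s [])
  tower-walk i t s = tower-bridge i t s (edge (gap-edge t i (raise m (bit t))))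

  evenTower : ℕ → Parity → List Cell → List Cell
  evenTower zero    t vs = tower 0 t (evenFirst t) vs
  evenTower (suc n) t _  = tower (suc n * 2) t (evenNext t) []

  evens : ℕ → Parity → List Cell → List Cell
  evens zero    t vs = evenTower zero t vs
  evens (suc n) t vs = evens n t vs ++ evenTower (suc n) t vs

  -- The walk through the first tower is left as an argument because its topmost gap is filled in
  -- two ways: by the odd walk for j even, by its own edge for j odd.
  evens-walk : ∀ n t {vs} →
    Walk a (place 0 (bit t) (6 , 6)) (place 0 (bit t) (5 , 5)) (tower 0 t (evenFirst t) vs) →
    Walk a (place 0 (bit t) (6 , 6)) (place (n * 2) (bit t) (5 , 5)) (evens n t vs)
  evens-walk zero    t w = w
  evens-walk (suc n) t w =
    join (evens-walk n t w) (even-even n (bit t)) (tower-walk (suc n * 2) t (evenNext t))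

  oddTower : ℕ → Parity → List Cell
  oddTower zero    t = tower 1 t (oddLast t) []
  oddTower (suc n) t = tower (suc (suc n * 2)) t (oddNext t) []

  odds : ℕ → Parity → List Cell
  odds zero    t = oddTower zero t
  odds (suc n) t = oddTower (suc n) t ++ odds n t

  odds-walk : ∀ n t → Walk a (place (suc (n * 2)) (bit t) (4 , 4)) (place 1 (bit t) (oddEnd t)) (odds n t)
  odds-walk zero    t = tower-walk 1 t (oddLast t)
  odds-walk (suc n) t =
    join (tower-walk (suc (suc n * 2)) t (oddNext t)) (odd-odd n (bit t)) (odds-walk n t)

  oddTour : List Cell
  oddTour = trace 1 0 oddHead ++ odds m 1ℙ ++ odds m 0ℙ

  -- The head leaves the grid (1 , 0) for the towers at j = 1; the second wrap returns to j = 0,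
  -- where the last tower ends beside the start.
  oddTour-walk : Walk a (place 1 0 (2 , 2)) (place 1 0 (2 , 3)) oddTour
  oddTour-walk = join (trace-walk 1 0 oddHead) (odd-wrap 0)
    (join (odds-walk m 1ℙ) (odd-wrap 1) (odds-walk m 0ℙ))

  tour : List Cell
  tour = evens m 0ℙ oddTour ++ evens m 1ℙ []

  tour-walk : Walk a (place 0 0 (6 , 6)) (place (m * 2) 1 (5 , 5)) tour
  tour-walk = join
    (evens-walk m 0ℙ (tower-bridge 0 0ℙ (evenFirst 0ℙ) bridge))
    (even-wrap 0)
    (evens-walk m 1ℙ (tower-walk 0 1ℙ (evenFirst 1ℙ)))
    where
    -- The topmost gap over (0 , 0) lies at j = a - 2, the only even index whose twisted offset
    -- borders the next block of rows.
    raise-m : raise m 0 ≡ m * 2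
    raise-m = trans (raise-* m 0) (+-identityʳ (m * 2))
    bridge : Bridge a (place 0 (raise m 0) (3 , 1)) (place 0 (raise m 0) (3 , 2)) oddTour
    bridge rewrite raise-m = span even-odd oddTour-walk odd-even

  tour-closed : All (λ p → KnightAdj a (proj₁ p) (proj₂ p)) (cyclicPairs tour)
  tour-closed = closed-walk tour-walk (even-wrap 1)

  -- Length of the tour.

  length-nest : ∀ i t n j vs → length (nest i t n j vs) ≡ n * (size i * 6) + length vs
  length-nest i t zero    j vs = refl
  length-nest i t (suc n) j vs = begin
    length (trace i j b ++ xs ++ trace i j c)           ≡⟨ length-++ (trace i j b) ⟩
    length (trace i j b) + length (xs ++ trace i j c)   ≡⟨ cong (length (trace i j b) +_) (length-++ xs) ⟩
    length (trace i j b) + (length xs + length (trace i j c))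
      ≡⟨ lemma (length (trace i j b)) (length xs) (length (trace i j c)) ⟩
    length (trace i j b) + length (trace i j c) + length xs
      ≡⟨ cong₂ _+_ (filler-length i t) (length-nest i t n (2 + j) vs) ⟩
    size i * 6 + (n * (size i * 6) + length vs)         ≡⟨ +-assoc (size i * 6) _ _ ⟨
    suc n * (size i * 6) + length vs                    ∎
    where
    open ≡-Reasoning
    b = before (filler i t)
    c = after (filler i t)
    xs = nest i t n (2 + j) vs
    lemma : ∀ p q r → p + (q + r) ≡ p + r + q
    lemma = solve-∀
    filler-length : ∀ i t → length (trace i j (before (filler i t))) + length (trace i j (after (filler i t))) ≡ size i * 6
    filler-length 0             0ℙ = refl
    filler-length 0             1ℙ = refl
    filler-length 1             0ℙ = refl
    filler-length 1             1ℙ = refl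
    filler-length (suc (suc _)) 0ℙ = refl
    filler-length (suc (suc _)) 1ℙ = refl

  length-tower : ∀ {g h} i t (s : Split g h t) vs → length (tower i t s vs) ≡
    length (squares (before s)) + (m * (size i * 6) + length vs + length (squares (after s)))
  length-tower i t s vs = begin
    length (trace i (bit t) (before s) ++ xs ++ ys)          ≡⟨ length-++ (trace i (bit t) (before s)) ⟩
    length (trace i (bit t) (before s)) + length (xs ++ ys)  ≡⟨ cong₂ _+_ (length-map _ (squares (before s))) (length-++ xs) ⟩
    length (squares (before s)) + (length xs + length ys)
      ≡⟨ cong (length (squares (before s)) +_) (cong₂ _+_ (length-nest i t m (2 + bit t) vs) (length-map _ (squares (after s)))) ⟩
    length (squares (before s)) + (m * (size i * 6) + length vs + length (squares (after s))) ∎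
    where
    open ≡-Reasoning
    xs = nest i t m (2 + bit t) vs
    ys = trace i (bit t) (after s)

  -- The tower at i = 0 has one 7 × 7 grid and m grids 7 × 6; each of the n others has one 6 × 7 and
  -- m grids 6 × 6.
  length-evens : ∀ n t vs → length (evens n t vs) ≡ 49 + m * 42 + length vs + n * (42 + m * 36)
  length-evens zero t vs = trans (length-tower 0 t (evenFirst t) vs) (eq t)
    where
    -- 29 and 20 are the lengths of `before` and `after`; for the other parity they are 35 and 14.
    eq₀ : ∀ m l → 29 + (m * 42 + l + 20) ≡ 49 + m * 42 + l + 0
    eq₀ = solve-∀
    eq₁ : ∀ m l → 35 + (m * 42 + l + 14) ≡ 49 + m * 42 + l + 0
    eq₁ = solve-∀
    eq : ∀ t → length (squares (before (evenFirst t))) + (m * 42 + length vs + length (squares (after (evenFirst t))))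
      ≡ 49 + m * 42 + length vs + 0
    eq 0ℙ = eq₀ m (length vs)
    eq 1ℙ = eq₁ m (length vs)
  length-evens (suc n) t vs = begin
    length (evens n t vs ++ evenTower (suc n) t vs)
      ≡⟨ length-++ (evens n t vs) ⟩
    length (evens n t vs) + length (evenTower (suc n) t vs)
      ≡⟨ cong₂ _+_ (length-evens n t vs) (trans (length-tower (suc n * 2) t (evenNext t) []) (eq t)) ⟩
    49 + m * 42 + length vs + n * (42 + m * 36) + (42 + m * 36)
      ≡⟨ eq′ (49 + m * 42 + length vs) n (42 + m * 36) ⟩
    49 + m * 42 + length vs + suc n * (42 + m * 36) ∎
    where
    open ≡-Reasoning
    eq′ : ∀ p n q → p + n * q + q ≡ p + suc n * q
    eq′ = solve-∀
    eq₀ : ∀ m → 10 + (m * 36 + 0 + 32) ≡ 42 + m * 36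
    eq₀ = solve-∀
    eq₁ : ∀ m → 20 + (m * 36 + 0 + 22) ≡ 42 + m * 36
    eq₁ = solve-∀
    eq : ∀ t → length (squares (before (evenNext t))) + (m * 36 + 0 + length (squares (after (evenNext t)))) ≡ 42 + m * 36
    eq 0ℙ = eq₀ m
    eq 1ℙ = eq₁ m

  -- 38 is 49 less the 11 squares of `oddHead`.
  oddLastLength : Parity → ℕ
  oddLastLength 0ℙ = 38
  oddLastLength 1ℙ = 49

  length-odds : ∀ n t → length (odds n t) ≡ n * (42 + m * 36) + (oddLastLength t + m * 42)
  length-odds zero t = trans (length-tower 1 t (oddLast t) []) (eq t)
    where
    eq₀ : ∀ m → 33 + (m * 42 + 0 + 5) ≡ 38 + m * 42
    eq₀ = solve-∀
    eq₁ : ∀ m → 39 + (m * 42 + 0 + 10) ≡ 49 + m * 42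
    eq₁ = solve-∀
    eq : ∀ t → length (squares (before (oddLast t))) + (m * 42 + 0 + length (squares (after (oddLast t))))
      ≡ oddLastLength t + m * 42
    eq 0ℙ = eq₀ m
    eq 1ℙ = eq₁ m
  length-odds (suc n) t = begin
    length (oddTower (suc n) t ++ odds n t)
      ≡⟨ length-++ (oddTower (suc n) t) ⟩
    length (oddTower (suc n) t) + length (odds n t)
      ≡⟨ cong₂ _+_ (trans (length-tower (suc (suc n * 2)) t (oddNext t) []) (eq t)) (length-odds n t) ⟩
    42 + m * 36 + (n * (42 + m * 36) + (oddLastLength t + m * 42))
      ≡⟨ +-assoc (42 + m * 36) _ _ ⟨
    suc n * (42 + m * 36) + (oddLastLength t + m * 42) ∎
    where
    open ≡-Reasoning
    eq₀ : ∀ m → 27 + (m * 36 + 0 + 15) ≡ 42 + m * 36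
    eq₀ = solve-∀
    eq₁ : ∀ m → 33 + (m * 36 + 0 + 9) ≡ 42 + m * 36
    eq₁ = solve-∀
    eq : ∀ t → length (squares (before (oddNext t))) + (m * 36 + 0 + length (squares (after (oddNext t)))) ≡ 42 + m * 36
    eq 0ℙ = eq₀ m
    eq 1ℙ = eq₁ m

  side : ℕ
  side = 6 * a + 2

  -- Four grids of 49 squares, 8m of 42 and 4m² of 36 add up to (12m + 14)².
  length-tour : length tour ≡ side * side
  length-tour = begin
    length (evens m 0ℙ oddTour ++ evens m 1ℙ [])
      ≡⟨ length-++ (evens m 0ℙ oddTour) ⟩
    length (evens m 0ℙ oddTour) + length (evens m 1ℙ [])
      ≡⟨ cong₂ _+_ (length-evens m 0ℙ oddTour) (length-evens m 1ℙ []) ⟩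
    49 + m * 42 + length oddTour + m * (42 + m * 36) + (49 + m * 42 + 0 + m * (42 + m * 36))
      ≡⟨ cong (λ l → 49 + m * 42 + l + m * (42 + m * 36) + (49 + m * 42 + 0 + m * (42 + m * 36))) length-oddTour ⟩
    49 + m * 42 + (11 + (m * (42 + m * 36) + (49 + m * 42) + (m * (42 + m * 36) + (38 + m * 42))))
      + m * (42 + m * 36) + (49 + m * 42 + 0 + m * (42 + m * 36))
      ≡⟨ eq m ⟩
    side * side ∎
    where
    open ≡-Reasoning
    length-oddTour : length oddTour ≡
      11 + (m * (42 + m * 36) + (49 + m * 42) + (m * (42 + m * 36) + (38 + m * 42)))
    length-oddTour = cong (11 +_) (trans (length-++ (odds m 1ℙ)) (cong₂ _+_ (length-odds m 1ℙ) (length-odds m 0ℙ)))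
    eq : ∀ m →
      49 + m * 42 + (11 + (m * (42 + m * 36) + (49 + m * 42) + (m * (42 + m * 36) + (38 + m * 42))))
        + m * (42 + m * 36) + (49 + m * 42 + 0 + m * (42 + m * 36))
      ≡ (6 * (suc m * 2) + 2) * (6 * (suc m * 2) + 2)
    eq = solve-∀

  -- Coverage of every grid by the tour.

  -- A grid is met in separate pieces. Each must occur contiguously, since membership alone would
  -- lose the required edge.
  Surveyed : ℕ → ℕ → List Cell → Set
  Surveyed i j vs = ∃ λ ss → Complete (size i) (size j) ss × All (λ s → map (place i j) s ⊑ vs) ss

  Surveyed-⊑ : ∀ {i j vs ws} → vs ⊑ ws → Surveyed i j vs → Surveyed i j ws
  Surveyed-⊑ vs⊑ws (ss , c , ss⊑) = ss , c , All.map (λ s⊑ → ⊑-trans s⊑ vs⊑ws) ss⊑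

  -- The form `2 + j` lets the height of the lowest filler reduce to 6.
  nest-surveyed : ∀ i t {n j vs J} → J < n → Surveyed i (raise J (2 + j)) (nest i t n (2 + j) vs)
  nest-surveyed i t {suc n} {j} {vs} {zero} _ =
    parts (filler i t) , filler-complete i t ,
    prefix _ ∷ ⊑-++ˡ (trace i (2 + j) (before (filler i t))) (suffix (nest i t n (4 + j) vs)) ∷ []
  nest-surveyed i t {suc n} {j} {vs} {suc J} (s≤s J<n) =
    Surveyed-⊑ (⊑-++ˡ (trace i (2 + j) (before (filler i t))) (prefix _)) (nest-surveyed i t J<n)

  tower-parts : ∀ {g h} i t (s : Split g h t) vs →
    All (λ r → map (place i (bit t)) r ⊑ tower i t s vs) (parts s)
  tower-parts i t s vs =
    prefix _ ∷ ⊑-++ˡ (trace i (bit t) (before s)) (suffix (nest i t m (2 + bit t) vs)) ∷ []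

  tower-upper : ∀ {g h} i t (s : Split g h t) vs {J} → J < m →
    Surveyed i (raise (suc J) (bit t)) (tower i t s vs)
  tower-upper i t s vs J<m =
    Surveyed-⊑ (⊑-++ˡ (trace i (bit t) (before s)) (prefix _)) (nest-surveyed i t J<m)

  tower-surveyed : ∀ {g h} i t (s : Split g h t) vs → Complete (size i) 7 (parts s) →
    ∀ {J} → J ≤ m → Surveyed i (raise J (bit t)) (tower i t s vs)
  -- Splitting on the parity lets `size (bit t)` reduce to 7.
  tower-surveyed i 0ℙ s vs c {zero}  _   = parts s , c , tower-parts i 0ℙ s vs
  tower-surveyed i 1ℙ s vs c {zero}  _   = parts s , c , tower-parts i 1ℙ s vs
  tower-surveyed i t  s vs c {suc J} J<m = tower-upper i t s vs J<m

  evenTower-⊑ : ∀ {n t vs I} → I ≤ n → evenTower I t vs ⊑ evens n t vs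
  evenTower-⊑ {zero}  z≤n = [] , [] , sym (++-identityʳ _)
  evenTower-⊑ {suc n} {t} {vs} I≤ with m≤n⇒m<n∨m≡n I≤
  ... | inj₁ (s≤s I≤n) = ⊑-++ʳ (evenTower (suc n) t vs) (evenTower-⊑ I≤n)
  ... | inj₂ refl      = suffix (evens n t vs)

  oddTower-⊑ : ∀ {n t I} → I ≤ n → oddTower I t ⊑ odds n t
  oddTower-⊑ {zero}  z≤n = [] , [] , sym (++-identityʳ _)
  oddTower-⊑ {suc n} {t} I≤ with m≤n⇒m<n∨m≡n I≤
  ... | inj₁ (s≤s I≤n) = ⊑-++ˡ (oddTower (suc n) t) (oddTower-⊑ I≤n)
  ... | inj₂ refl      = prefix (odds n t)

  evenTower-surveyed : ∀ I t {vs J} → J ≤ m → Surveyed (I * 2) (raise J (bit t)) (evenTower I t vs)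
  evenTower-surveyed zero    t = tower-surveyed 0 t (evenFirst t) _ (evenFirst-complete t)
  evenTower-surveyed (suc I) t = tower-surveyed (suc I * 2) t (evenNext t) [] (evenNext-complete t)

  odds-⊑ : ∀ t → odds m t ⊑ oddTour
  odds-⊑ 0ℙ = ⊑-++ˡ (trace 1 0 oddHead) (suffix (odds m 1ℙ))
  odds-⊑ 1ℙ = ⊑-++ˡ (trace 1 0 oddHead) (prefix (odds m 0ℙ))

  oddTour-surveyed : ∀ {I} t {J} → I ≤ m → J ≤ m → Surveyed (suc (I * 2)) (raise J (bit t)) oddTour
  oddTour-surveyed {zero} 0ℙ {zero} I≤m _ =
    squares oddHead ∷ parts (oddLast 0ℙ) , oddLast₀-complete ,
    prefix _ ∷ All.map (λ s⊑ → ⊑-trans s⊑ (⊑-trans (oddTower-⊑ I≤m) (odds-⊑ 0ℙ)))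
                       (tower-parts 1 0ℙ (oddLast 0ℙ) [])
  oddTour-surveyed {zero} 0ℙ {suc J} I≤m J<m =
    Surveyed-⊑ (⊑-trans (oddTower-⊑ I≤m) (odds-⊑ 0ℙ)) (tower-upper 1 0ℙ (oddLast 0ℙ) [] J<m)
  oddTour-surveyed {zero} 1ℙ I≤m J≤m =
    Surveyed-⊑ (⊑-trans (oddTower-⊑ I≤m) (odds-⊑ 1ℙ))
      (tower-surveyed 1 1ℙ (oddLast 1ℙ) [] oddLast₁-complete J≤m)
  oddTour-surveyed {suc I} t I≤m J≤m =
    Surveyed-⊑ (⊑-trans (oddTower-⊑ I≤m) (odds-⊑ t))
      (tower-surveyed (suc (suc I * 2)) t (oddNext t) [] (oddNext-complete t) J≤m)

  oddTour-⊑ : oddTour ⊑ tour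
  oddTour-⊑ = ⊑-++ʳ (evens m 1ℙ []) (⊑-trans (go m (2 + bit 0ℙ)) (⊑-trans
    (⊑-++ˡ (trace 0 0 (before (evenFirst 0ℙ))) (prefix _)) (evenTower-⊑ {m} z≤n)))
    where
    go : ∀ n j → oddTour ⊑ nest 0 0ℙ n j oddTour
    go zero    j = [] , [] , sym (++-identityʳ _)
    go (suc n) j = ⊑-++ˡ (trace 0 j (before (wide 0ℙ))) (⊑-++ʳ _ (go n (2 + j)))

  tour-surveyed : ∀ {i j} → i < a → j < a → Surveyed i j tour
  tour-surveyed i<a j<a with halve (suc m) i<a | halve (suc m) j<a
  ... | I , s , s≤s I≤m , refl | J , t , s≤s J≤m , refl =
    subst (λ j → Surveyed (bit s + I * 2) j tour) (trans (raise-* J (bit t)) (+-comm (J * 2) (bit t))) (go s t)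
    where
    go : ∀ s t → Surveyed (bit s + I * 2) (raise J (bit t)) tour
    go 0ℙ 0ℙ = Surveyed-⊑ (⊑-++ʳ (evens m 1ℙ []) (evenTower-⊑ I≤m)) (evenTower-surveyed I 0ℙ J≤m)
    go 0ℙ 1ℙ = Surveyed-⊑ (⊑-++ˡ (evens m 0ℙ oddTour) (evenTower-⊑ I≤m)) (evenTower-surveyed I 1ℙ J≤m)
    go 1ℙ t  = Surveyed-⊑ oddTour-⊑ (oddTour-surveyed t I≤m J≤m)

  place-∈-tour : ∀ {i j α β} → i < a → j < a → α < size i → β < size j → place i j (α , β) ∈ tour
  place-∈-tour {i} {j} i<a j<a α< β< with tour-surveyed {i} {j} i<a j<a
  ... | ss , (c , _) , ss⊑ =
    go ss⊑ (lookup c (∈-cartesianProduct⁺ (∈-upTo⁺ α<) (∈-upTo⁺ β<)))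
    where
    go : ∀ {g ss} → All (λ s → map (place i j) s ⊑ tour) ss → Any (g ∈_) ss → place i j g ∈ tour
    go (s⊑ ∷ _)  (here g∈s) = ∈-⊑ s⊑ (∈-map⁺ (place i j) g∈s)
    go (_ ∷ ss⊑) (there p)  = go ss⊑ p

  tour-structured : Structured a tour
  tour-structured i j i<a j<a with tour-surveyed {i} {j} i<a j<a
  ... | ss , (_ , e) , ss⊑ =
    -- The square (1 , 0) has first coordinate `1 * a + i` instead of `i + a`; the twist in column 1
    -- already gives `alt j`.
    subst (λ x → EdgeOf (i , j) (x , alt j) tour)
      (trans (cong (_+ i) (+-identityʳ a)) (+-comm a i)) (go ss⊑ e)
    where
    go : ∀ {ss} → All (λ s → map (place i j) s ⊑ tour) ss → Any (Joined (0 , 0) (1 , 0)) ss →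
      EdgeOf (place i j (0 , 0)) (place i j (1 , 0)) tour
    go (s⊑ ∷ _)  (here (inj₁ p)) = inj₁ (Next⇒cyclic (Next-⊑ s⊑ (Next-map (place i j) p)))
    go (s⊑ ∷ _)  (here (inj₂ p)) = inj₂ (Next⇒cyclic (Next-⊑ s⊑ (Next-map (place i j) p)))
    go (_ ∷ ss⊑) (there p)       = go ss⊑ p

  -- From cells of the board back to grids.

  side≤7a : side ≤ 7 * a
  side≤7a = subst (side ≤_) (+-comm (6 * a) a) (+-monoʳ-≤ (6 * a) (s≤s (s≤s z≤n)))

  -- The side consists of six full blocks and two further coordinates, so quotient 6 occurs only
  -- with remainder 0 or 1.
  quotient-<-size : ∀ x → x < side → x / a < size (x % a)
  quotient-<-size x x< with x % a in eq
  ... | 0           = m<n*o⇒m/o<n (<-≤-trans x< side≤7a)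
  ... | 1           = m<n*o⇒m/o<n (<-≤-trans x< side≤7a)
  -- A remainder of at least 2 gives `x / a * a + 2 ≤ x < 6 * a + 2`.
  ... | suc (suc r) = *-cancelʳ-< a (x / a) 6 (+-cancelʳ-< 2 (x / a * a) (6 * a) (≤-<-trans le x<))
    where
    le : x / a * a + 2 ≤ x
    le = begin
      x / a * a + 2         ≡⟨ +-comm (x / a * a) 2 ⟩
      2 + x / a * a         ≤⟨ +-monoˡ-≤ (x / a * a) (s≤s (s≤s z≤n)) ⟩
      2 + r + x / a * a     ≡⟨ cong (_+ x / a * a) eq ⟨
      x % a + x / a * a     ≡⟨ m≡m%n+[m/n]*n x a ⟨
      x                     ∎
      where open ≤-Reasoning

  -- This inverts `place`: the quotients give the square, and twisting each remainder by the other
  -- quotient recovers the index, `twist` being an involution.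
  board⊆tour : ∀ {c} → OnBoard side c → c ∈ tour
  board⊆tour {x , y} (x< , y<) = subst (_∈ tour) (cong₂ _,_ (eq x β) (eq y α))
    (place-∈-tour {twist β (x % a)} {twist α (y % a)}
      (twist-< β (suc m) (m%n<n x a)) (twist-< α (suc m) (m%n<n y a))
      (subst (α <_) (sym (size-twist β (x % a))) (quotient-<-size x x<))
      (subst (β <_) (sym (size-twist α (y % a))) (quotient-<-size y y<)))
    where
    α = x / a
    β = y / a
    eq : ∀ z k → z / a * a + twist k (twist k (z % a)) ≡ z
    eq z k = begin
      z / a * a + twist k (twist k (z % a))   ≡⟨ cong (z / a * a +_) (twist-involutive k (z % a)) ⟩
      z / a * a + z % a                       ≡⟨ +-comm (z / a * a) (z % a) ⟩
      z % a + z / a * a                       ≡⟨ m≡m%n+[m/n]*n z a ⟨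
      z                                       ∎
      where open ≡-Reasoning

  tour-↭-board : tour ↭ board side
  tour-↭-board = ⊆∧length⇒↭ (board-Unique side) (λ c∈ → board⊆tour (board-∈ c∈))
    (trans length-tour (sym (length-board side)))

  tour-isStructuredTour : StructuredKnightTour a side tour
  tour-isStructuredTour =
    ( subst (3 ≤_) (sym length-tour) (≤-trans (s≤s (s≤s (s≤s z≤n))) (*-mono-≤ 2≤side 2≤side))
    -- This component and the next are inherited from `board side` along the permutation.
    , All-resp-↭ (↭-sym tour-↭-board) (board-OnBoard side)
    , Unique-resp-↭ (↭⇒↭ₛ (↭-sym tour-↭-board)) (board-Unique side)
    , length-tour
    , tour-closed
    ) , tour-structured
    where
    2≤side : 2 ≤ side
    2≤side = m≤n+m 2 (6 * a)

theorem9 : (a : ℕ) → 2 ∣ a → 0 < a →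
    ∃ (λ vs → StructuredKnightTour a (6 * a + 2) vs)
theorem9 _ (divides zero    refl) ()
theorem9 _ (divides (suc m) refl) _ = tour m , tour-isStructuredTour m
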